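{- Let $k\ge 3$ be an integer. There is a constant $C$ (independent of $n$ and $\delta$) such that for every connected $k$-colorable graph $G$ of order $n$ with minimum degree at least $\delta\ge 1$, \[ \operatorname{diam}(G)\le \frac{3k-4}{k-1}\cdot\frac{n}{\delta}+C=\left(3-\frac{1}{k-1}\right)\frac{n}{\delta}+C. \]
   Context: $\operatorname{diam}(G)$ denotes the diameter of $G$, i.e. the maximum distance between two vertices. The paper writes the additive term as $O(1)$. -}

module Defs where

open import Data.Nat using (ℕ; zero; suc; _≤_)
open import Data.Fin using (Fin)
open import Data.List using (List; length; filter; allFin)
open import Data.Product using (∃; Σ; _×_)
open import Relation.Nullary using (¬_)
open import Relation.Binary.PropositionalEquality using (_≡_; _≢_)
open import Relation.Binary using (Decidable)
open import Level using (0ℓ)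

record Graph (n : ℕ) : Set₁ where
  field
    Adj    : Fin n → Fin n → Set
    adj?   : Decidable Adj
    sym    : ∀ {u v} → Adj u v → Adj v u
    irrefl : ∀ {u} → ¬ Adj u u
open Graph public

degree : ∀ {n} → Graph n → Fin n → ℕ
degree G v = length (filter (adj? G v) (allFin _))

MinDegreeAtLeast : ∀ {n} → Graph n → ℕ → Set
MinDegreeAtLeast G δ = ∀ v → δ ≤ degree G v

data Walk {n} (G : Graph n) : Fin n → Fin n → ℕ → Set where
  here : ∀ {u} → Walk G u u zero
  step : ∀ {u w v l} → Adj G u w → Walk G w v l → Walk G u v (suc l)

DistAtMost : ∀ {n} → Graph n → Fin n → Fin n → ℕ → Set
DistAtMost G u v d = Σ ℕ (λ l → Walk G u v l × l ≤ d)

Connected : ∀ {n} → Graph n → Set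
Connected G = ∀ u v → ∃ (λ l → Walk G u v l)

Colorable : ∀ {n} → ℕ → Graph n → Set
Colorable {n} k G = Σ (Fin n → Fin k) (λ c → ∀ {u v} → Adj G u v → c u ≢ c v)

{-# OPTIONS --safe #-}

-- Let S i be the size of the i-th distance layer from u, T = S i + S (1 + i) +
-- S (2 + i), and m = k − 1.  A vertex of colour c in layer 1 + i has its δ
-- neighbours among the vertices counted by T that do not have colour c.
-- Summing this over colours gives m T ≥ m δ + S (1 + i) if layer 1 + i misses
-- a colour, and m T ≥ (m + 1) δ if it does not.  The second bound is weaker than
-- the first only if S (1 + i) > δ, and then the surplus S (1 + i) − δ is available
-- when the next layer is treated.  Carrying this surplus along and adding up the
-- inequalities m T − S (1 + i) ≥ m δ over all layers, where every vertex is
-- counted at most 3m − 1 = 3k − 4 times, gives the bound with C = 0.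
module Submission where

open import Defs
open import Data.Nat using (ℕ; zero; suc; _+_; _*_; _∸_; _≤_; _<_; z≤n; s≤s; _≟_; _<?_)
open import Data.Nat.Properties hiding (_≟_; _<?_)
open import Data.Nat.Tactic.RingSolver using (solve-∀)
open import Data.Fin using (Fin; zero; suc; punchIn)
open import Data.Fin.Properties using (any?) renaming (_≟_ to _≟ᶠ_)
open import Data.List using (length; filter; tabulate)
open import Data.Product using (Σ; ∃; _×_; _,_; proj₁; proj₂)
open import Data.Sum using (_⊎_; inj₁; inj₂)
open import Data.Vec.Functional using (removeAt)
open import Function using (_∘_; id)
open import Relation.Nullary using (Dec; yes; no; ¬_; contradiction)
open import Relation.Nullary.Decidable using (map′; _×-dec_; ¬?; decidable-stable)
open import Relation.Unary using (Pred) renaming (Decidable to Decidable₁)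
open import Relation.Binary.PropositionalEquality
  using (_≡_; refl; trans; cong; cong₂; subst) renaming (sym to ≡-sym)
open import Algebra.Properties.Semiring.Sum +-*-semiring
  using (sum; sum-remove; ∑-distrib-+; ∑-comm)
open ≤-Reasoning

-- Finite sums, indicators and least witnesses.

sum-mono : ∀ {n} {f g : Fin n → ℕ} → (∀ i → f i ≤ g i) → sum f ≤ sum g
sum-mono {zero}  f≤g = z≤n
sum-mono {suc n} f≤g = +-mono-≤ (f≤g zero) (sum-mono (f≤g ∘ suc))

sum-const : ∀ n x → sum {n} (λ _ → x) ≡ n * x
sum-const zero    x = refl
sum-const (suc n) x = cong (x +_) (sum-const n x)

lookup≤sum : ∀ {n} (f : Fin n → ℕ) i → f i ≤ sum f
lookup≤sum f zero    = m≤m+n _ _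
lookup≤sum f (suc i) = ≤-trans (lookup≤sum (f ∘ suc) i) (m≤n+m _ _)

∑-distrib-+₃ : ∀ {n} (f g h : Fin n → ℕ) →
               sum (λ i → f i + g i + h i) ≡ sum f + sum g + sum h
∑-distrib-+₃ f g h =
  trans (∑-distrib-+ (λ i → f i + g i) h) (cong (_+ sum h) (∑-distrib-+ f g))

𝟙 : ∀ {A : Set} → Dec A → ℕ
𝟙 (yes _) = 1
𝟙 (no _)  = 0

𝟙-yes : ∀ {A : Set} (A? : Dec A) → A → 𝟙 A? ≡ 1
𝟙-yes (yes _) _ = refl
𝟙-yes (no ¬a) a = contradiction a ¬a

𝟙-no : ∀ {A : Set} (A? : Dec A) → ¬ A → 𝟙 A? ≡ 0
𝟙-no (yes a) ¬a = contradiction a ¬a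
𝟙-no (no _)  _  = refl

𝟙≤1 : ∀ {A : Set} (A? : Dec A) → 𝟙 A? ≤ 1
𝟙≤1 (yes _) = ≤-refl
𝟙≤1 (no _)  = z≤n

length-filter-tabulate : ∀ {A : Set} {P : Pred A _} (P? : Decidable₁ P) {n} (f : Fin n → A) →
                         length (filter P? (tabulate f)) ≡ sum (λ i → 𝟙 (P? (f i)))
length-filter-tabulate P? {zero}  f = refl
length-filter-tabulate P? {suc n} f with P? (f zero)
... | yes _ = cong suc (length-filter-tabulate P? (f ∘ suc))
... | no _  = length-filter-tabulate P? (f ∘ suc)

-- Candidates are tested from 0 upwards by shifting the predicate; the known witness `n` bounds the
-- number of shifts.
least : ∀ {P : ℕ → Set} → Decidable₁ P → ∀ n → P n → ∃ λ m → P m × (∀ j → P j → m ≤ j)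
least P? n pn with P? 0
least P? n       pn | yes p0 = 0 , p0 , λ _ _ → z≤n
least P? zero    pn | no ¬p0 = contradiction pn ¬p0
least {P} P? (suc n) pn | no ¬p0 with least (P? ∘ suc) n pn
... | m , pm , min = suc m , pm , min′
  where
  min′ : ∀ j → P j → suc m ≤ j
  min′ zero    p = contradiction p ¬p0
  min′ (suc j) p = s≤s (min j p)

-- Walks and distance from a fixed vertex.

module _ {n} (G : Graph n) where

  -- For a fixed length the first step ranges over finitely many vertices; this decidability lets
  -- `least` select a shortest walk.
  walk? : ∀ l u v → Dec (Walk G u v l)
  walk? zero    u v = map′ (λ { refl → here }) (λ { here → refl }) (u ≟ᶠ v)
  walk? (suc l) u v =
    map′ (λ { (_ , a , p) → step a p }) (λ { (step a p) → _ , a , p })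
         (any? (λ w → adj? G u w ×-dec walk? l w v))

  _∷ʳ_ : ∀ {u v w l} → Walk G u v l → Adj G v w → Walk G u w (suc l)
  here     ∷ʳ b = step b here
  step a p ∷ʳ b = step a (p ∷ʳ b)

  -- By symmetry of `Adj`, the one-sided bound amounts to |e v - e w| ≤ 1 on every edge.
  Lipschitz : (Fin n → ℕ) → Set
  Lipschitz e = ∀ {v w} → Adj G v w → e w ≤ suc (e v)

  -- Along the walk `e` rises by at most one per step, so it cannot jump over `i`. This is what
  -- makes the layers nonempty.
  intermediate-value : ∀ {e} → Lipschitz e → ∀ {x v l} → Walk G x v l →
                       ∀ {i} → e x ≤ i → i ≤ e v → ∃ λ w → e w ≡ i
  intermediate-value lip {x} here lo hi = x , ≤-antisym lo hi
  intermediate-value lip {x} (step a p) lo hi with m≤n⇒m<n∨m≡n lo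
  ... | inj₂ eq = x , eq
  ... | inj₁ lt = intermediate-value lip p (≤-trans (lip a) lt) hi

  module Distance (conn : Connected G) (u : Fin n) where

    shortest : ∀ v → ∃ λ d → Walk G u v d × (∀ j → Walk G u v j → d ≤ j)
    shortest v = least (λ l → walk? l u v) (proj₁ (conn u v)) (proj₂ (conn u v))

    dist : Fin n → ℕ
    dist v = proj₁ (shortest v)

    dist-walk : ∀ v → Walk G u v (dist v)
    dist-walk v = proj₁ (proj₂ (shortest v))

    dist-lipschitz : Lipschitz dist
    dist-lipschitz {v} {w} a = proj₂ (proj₂ (shortest w)) _ (dist-walk v ∷ʳ a)

    dist-refl : dist u ≡ 0
    dist-refl = n≤0⇒n≡0 (proj₂ (proj₂ (shortest u)) 0 here)

-- With m = 1 + q, this is m (s + t + r) − t + m (t ∸ δ) ≥ m δ + m (s ∸ δ).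
surplus-step : ∀ q δ s t r →
  let m = suc q; T = s + t + r in
  m * δ + t ≤ m * T ⊎ suc m * δ ≤ m * T →
  m * δ + m * (s ∸ δ) ≤ m * s + q * t + m * r + m * (t ∸ δ)
surplus-step q δ s t r bound with ≤-total δ s
-- The left side collapses to `suc q * s`, which is already the first term on the right.
... | inj₁ δ≤s = begin
  suc q * δ + suc q * (s ∸ δ)  ≡⟨ *-distribˡ-+ (suc q) δ (s ∸ δ) ⟨
  suc q * (δ + (s ∸ δ))        ≡⟨ cong (suc q *_) (m+[n∸m]≡n δ≤s) ⟩
  suc q * s                    ≤⟨ m≤m+n _ (q * t) ⟩
  suc q * s + q * t            ≤⟨ m≤m+n _ _ ⟩
  suc q * s + q * t + suc q * r  ≤⟨ m≤m+n _ _ ⟩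
  suc q * s + q * t + suc q * r + suc q * (t ∸ δ) ∎
... | inj₂ s≤δ rewrite m≤n⇒m∸n≡0 s≤δ | *-zeroʳ q | +-identityʳ (suc q * δ) =
  -- With no surplus on the left, adding `t` to both sides turns `q * t` into `suc q * t` and
  -- completes the multiple of T.
  +-cancelʳ-≤ t _ _ (subst (suc q * δ + t ≤_) (split q s t r (t ∸ δ)) (lemma bound))
  where
  split : ∀ q s t r p → suc q * (s + t + r) + suc q * p
                      ≡ suc q * s + q * t + suc q * r + suc q * p + t
  split = solve-∀
  lemma : _ → suc q * δ + t ≤ suc q * (s + t + r) + suc q * (t ∸ δ)
  lemma (inj₁ b) = ≤-trans b (m≤m+n _ _)
  lemma (inj₂ b) = begin
    -- Of `t`, a part of size δ completes the (m + 1)-st δ; the excess is covered by one of the m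
    -- copies of `t ∸ δ`.
    suc q * δ + t                           ≤⟨ +-monoʳ-≤ (suc q * δ) (m≤n+m∸n t δ) ⟩
    suc q * δ + (δ + (t ∸ δ))               ≡⟨ assoc′ (suc q * δ) δ (t ∸ δ) ⟩
    suc (suc q) * δ + (t ∸ δ)               ≤⟨ +-mono-≤ b (m≤m+n (t ∸ δ) _) ⟩
    suc q * (s + t + r) + suc q * (t ∸ δ)   ∎
    where
    assoc′ : ∀ x y z → x + (y + z) ≡ y + x + z
    assoc′ = solve-∀

-- Counting vertices by layer and colour.

module Layers {n q δ} (G : Graph n) (minDeg : MinDegreeAtLeast G δ)
              (col : Fin n → Fin (suc (suc q)))
              (proper : ∀ {u v} → Adj G u v → ¬ (col u ≡ col v))
              (e : Fin n → ℕ) (lip : Lipschitz G e) where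

  m k : ℕ
  m = suc q
  k = suc m

  inLayer : ℕ → Fin n → ℕ
  inLayer i v = 𝟙 (e v ≟ i)

  inClass : ℕ → Fin k → Fin n → ℕ
  inClass i c v = inLayer i v * 𝟙 (col v ≟ᶠ c)

  S : ℕ → ℕ
  S i = sum (inLayer i)

  A : ℕ → Fin k → ℕ
  A i c = sum (inClass i c)

  -- These are the partial sums of `S`, phrased as a vertex count so that the bound by `n` is
  -- immediate.
  below : ℕ → ℕ
  below b = sum (λ v → 𝟙 (e v <? b))

  T : ℕ → ℕ
  T i = S i + S (suc i) + S (suc (suc i))

  below≤n : ∀ b → below b ≤ n
  below≤n b = begin
    below b          ≤⟨ sum-mono (λ v → 𝟙≤1 (e v <? b)) ⟩
    sum {n} (λ _ → 1) ≡⟨ sum-const n 1 ⟩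
    n * 1            ≡⟨ *-identityʳ n ⟩
    n                ∎

  below-suc : ∀ b → below b + S b ≤ below (suc b)
  below-suc b = begin
    below b + S b                              ≡⟨ ∑-distrib-+ (λ v → 𝟙 (e v <? b)) (inLayer b) ⟨
    sum (λ v → 𝟙 (e v <? b) + inLayer b v)     ≤⟨ sum-mono pointwise ⟩
    below (suc b)                              ∎
    where
    pointwise : ∀ v → 𝟙 (e v <? b) + 𝟙 (e v ≟ b) ≤ 𝟙 (e v <? suc b)
    pointwise v with e v <? b | e v ≟ b
    ... | yes lt | yes eq = contradiction eq (<⇒≢ lt)
    ... | yes lt | no _   = ≤-reflexive (≡-sym (𝟙-yes (e v <? suc b) (m<n⇒m<1+n lt)))
    ... | no _   | yes eq = ≤-reflexive (≡-sym (𝟙-yes (e v <? suc b) (s≤s (≤-reflexive eq))))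
    ... | no _   | no _   = z≤n

  S≤ΣA : ∀ i → S i ≤ sum (A i)
  S≤ΣA i = begin
    S i                                     ≤⟨ sum-mono pointwise ⟩
    sum (λ v → sum (λ c → inClass i c v))   ≡⟨ ∑-comm (λ v c → inClass i c v) ⟩
    sum (A i)                               ∎
    where
    pointwise : ∀ v → inLayer i v ≤ sum (λ c → inClass i c v)
    pointwise v = begin
      inLayer i v             ≡⟨ *-identityʳ _ ⟨
      inLayer i v * 1         ≡⟨ cong (inLayer i v *_) (𝟙-yes (col v ≟ᶠ col v) refl) ⟨
      inClass i (col v) v     ≤⟨ lookup≤sum (λ c → inClass i c v) (col v) ⟩
      sum (λ c → inClass i c v) ∎

  -- Applying `lip` to the edge in both directions confines `e w` to the interval from i to i + 2.
  neighbour-layer : ∀ {i x w} → e x ≡ suc i → Adj G x w →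
                    1 ≤ inLayer i w + inLayer (suc i) w + inLayer (suc (suc i)) w
  neighbour-layer {i} {x} {w} ex a
    with e w ≟ i | e w ≟ suc i | e w ≟ suc (suc i)
  ... | yes _ | _     | _     = s≤s z≤n
  ... | no _  | yes _ | _     = s≤s z≤n
  ... | no _  | no _  | yes _ = ≤-refl
  ... | no ≢i | no ≢1+i | no ≢2+i = contradiction (≤-antisym hi lo) ≢2+i
    where
    hi : e w ≤ suc (suc i)
    hi = subst (λ z → e w ≤ suc z) ex (lip a)
    i≤ : i ≤ e w
    i≤ = ≤-pred (subst (_≤ suc (e w)) ex (lip (Graph.sym G a)))
    lo : suc (suc i) ≤ e w
    lo = ≤∧≢⇒< (≤∧≢⇒< i≤ (≢i ∘ ≡-sym)) (≢1+i ∘ ≡-sym)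

  -- The neighbours of `x` and the vertices of its own colour are disjoint sets, and within the
  -- three layers `T i` counts both.
  neighbourhood : ∀ {i} x → e x ≡ suc i →
                  let c = col x in δ + (A i c + A (suc i) c + A (suc (suc i)) c) ≤ T i
  neighbourhood {i} x ex = begin
    δ + (A i c + A i₁ c + A i₂ c)
      ≤⟨ +-monoˡ-≤ _ (minDeg x) ⟩
    degree G x + (A i c + A i₁ c + A i₂ c)
      ≡⟨ cong₂ _+_ (length-filter-tabulate (adj? G x) id)
                   (≡-sym (∑-distrib-+₃ (inClass i c) (inClass i₁ c) (inClass i₂ c))) ⟩
    sum (λ w → 𝟙 (adj? G x w)) + sum (λ w → inClass i c w + inClass i₁ c w + inClass i₂ c w)
      ≡⟨ ∑-distrib-+ (λ w → 𝟙 (adj? G x w)) _ ⟨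
    sum (λ w → 𝟙 (adj? G x w) + (inClass i c w + inClass i₁ c w + inClass i₂ c w))
      ≤⟨ sum-mono pointwise ⟩
    sum (λ w → inLayer i w + inLayer i₁ w + inLayer i₂ w)
      ≡⟨ ∑-distrib-+₃ (inLayer i) (inLayer i₁) (inLayer i₂) ⟩
    T i ∎
    where
    c = col x
    i₁ = suc i
    i₂ = suc i₁
    inClass≤inLayer : ∀ j w → inClass j c w ≤ inLayer j w
    inClass≤inLayer j w =
      ≤-trans (*-monoʳ-≤ (inLayer j w) (𝟙≤1 (col w ≟ᶠ c))) (≤-reflexive (*-identityʳ _))
    pointwise : ∀ w → 𝟙 (adj? G x w) + (inClass i c w + inClass i₁ c w + inClass i₂ c w)
                      ≤ inLayer i w + inLayer i₁ w + inLayer i₂ w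
    pointwise w with adj? G x w
    ... | no _ =
      +-mono-≤ (+-mono-≤ (inClass≤inLayer i w) (inClass≤inLayer i₁ w)) (inClass≤inLayer i₂ w)
    -- Properness makes all three colour terms vanish at a neighbour, leaving 1 on the left.
    ... | yes a
      rewrite 𝟙-no (col w ≟ᶠ c) (proper a ∘ ≡-sym)
            | *-zeroʳ (inLayer i w) | *-zeroʳ (inLayer i₁ w) | *-zeroʳ (inLayer i₂ w)
      = neighbour-layer ex a

  -- Lower bounds for three consecutive layers.

  Occurs : ℕ → Fin k → Set
  Occurs i c = ∃ λ v → e v ≡ i × col v ≡ c

  occurs? : ∀ i c → Dec (Occurs i c)
  occurs? i c = any? (λ v → (e v ≟ i) ×-dec (col v ≟ᶠ c))

  absent : ∀ {i c} → ¬ Occurs i c → A i c ≡ 0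
  absent {i} {c} ¬occ = n≤0⇒n≡0 (begin
    A i c             ≤⟨ sum-mono pointwise ⟩
    sum {n} (λ _ → 0) ≡⟨ sum-const n 0 ⟩
    n * 0             ≡⟨ *-zeroʳ n ⟩
    0                 ∎)
    where
    pointwise : ∀ v → inClass i c v ≤ 0
    pointwise v with e v ≟ i | col v ≟ᶠ c
    ... | yes p | yes r = contradiction (v , p , r) ¬occ
    ... | yes _ | no _  = z≤n
    ... | no _  | _     = z≤n

  occurring : ∀ {i c} → Occurs (suc i) c → δ + (A i c + A (suc i) c + A (suc (suc i)) c) ≤ T i
  occurring (v , ev , refl) = neighbourhood v ev

  -- If `c` occurs, a vertex of that colour gives the bound; otherwise the class is empty and the
  -- degree of `x` suffices.
  class-bound : ∀ {i} x → e x ≡ suc i → ∀ c → δ + A (suc i) c ≤ T i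
  class-bound {i} x ex c with occurs? (suc i) c
  ... | yes occ = ≤-trans (+-monoʳ-≤ δ (≤-trans (m≤n+m _ (A i c)) (m≤m+n _ _))) (occurring occ)
  ... | no ¬occ rewrite absent ¬occ =
    ≤-trans (+-monoʳ-≤ δ z≤n) (neighbourhood x ex)

  -- Sum `class-bound` over the m colours other than `c`; their classes already exhaust the layer.
  missing-colour : ∀ {i} x → e x ≡ suc i → ∀ c → ¬ Occurs (suc i) c →
                   m * δ + S (suc i) ≤ m * T i
  missing-colour {i} x ex c ¬occ = begin
    m * δ + S (suc i)                         ≤⟨ +-monoʳ-≤ (m * δ) (S≤ΣA (suc i)) ⟩
    m * δ + sum (A (suc i))                   ≡⟨ cong (m * δ +_) (sum-remove {i = c} (A (suc i))) ⟩
    m * δ + (A (suc i) c + sum others)        ≡⟨ cong (λ z → m * δ + (z + sum others)) (absent ¬occ) ⟩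
    m * δ + sum others                        ≡⟨ cong (_+ sum others) (sum-const m δ) ⟨
    sum {m} (λ _ → δ) + sum others            ≡⟨ ∑-distrib-+ {m} (λ _ → δ) others ⟨
    sum (λ j → δ + others j)                  ≤⟨ sum-mono {m} (λ j → class-bound x ex (punchIn c j)) ⟩
    sum {m} (λ _ → T i)                       ≡⟨ sum-const m (T i) ⟩
    m * T i                                   ∎
    where
    others : Fin m → ℕ
    others = removeAt (A (suc i)) c

  all-colours : ∀ {i} → (∀ c → Occurs (suc i) c) → suc m * δ ≤ m * T i
  -- Summing `occurring` over all k colours gives k δ plus all class sizes, at least `T i`, against
  -- k copies of `T i`; one copy cancels.
  all-colours {i} occ = +-cancelˡ-≤ (T i) _ _ (begin
    T i + k * δ
      ≤⟨ +-monoˡ-≤ (k * δ) (+-mono-≤ (+-mono-≤ (S≤ΣA i) (S≤ΣA i₁)) (S≤ΣA i₂)) ⟩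
    sum (A i) + sum (A i₁) + sum (A i₂) + k * δ
      ≡⟨ +-comm _ (k * δ) ⟩
    k * δ + (sum (A i) + sum (A i₁) + sum (A i₂))
      ≡⟨ cong₂ _+_ (sum-const k δ) (∑-distrib-+₃ (A i) (A i₁) (A i₂)) ⟨
    sum {k} (λ _ → δ) + sum (λ c → A i c + A i₁ c + A i₂ c)
      ≡⟨ ∑-distrib-+ {k} (λ _ → δ) (λ c → A i c + A i₁ c + A i₂ c) ⟨
    sum (λ c → δ + (A i c + A i₁ c + A i₂ c))
      ≤⟨ sum-mono (λ c → occurring (occ c)) ⟩
    sum {k} (λ _ → T i)
      ≡⟨ sum-const k (T i) ⟩
    T i + m * T i ∎)
    where
    i₁ = suc i
    i₂ = suc i₁

  layer-bound : ∀ {i} x → e x ≡ suc i →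
                m * δ + S (suc i) ≤ m * T i ⊎ suc m * δ ≤ m * T i
  layer-bound {i} x ex with any? (λ c → ¬? (occurs? (suc i) c))
  ... | yes (c , ¬occ) = inj₁ (missing-colour x ex c ¬occ)
  ... | no none =
    inj₂ (all-colours (λ c → decidable-stable (occurs? (suc i) c) (λ ¬occ → none (c , ¬occ))))

  -- The first three terms on the right dominate the sum over i < N of
  -- m S i + q S (1 + i) + m S (2 + i); the last one is the surplus of layer N.
  accumulated : ∀ N → (∀ i → i < N → ∃ λ x → e x ≡ suc i) →
    N * (m * δ) ≤ m * below N + q * below (suc N) + m * below (suc (suc N)) + m * (S N ∸ δ)
  accumulated zero    _        = z≤n
  accumulated (suc N) nonempty = begin
    m * δ + N * (m * δ)
      ≤⟨ +-monoʳ-≤ (m * δ) (accumulated N (λ i i<N → nonempty i (m<n⇒m<1+n i<N))) ⟩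
    m * δ + (W + m * (S N ∸ δ))
      ≡⟨ swap (m * δ) W _ ⟩
    W + (m * δ + m * (S N ∸ δ))
      -- The surplus of layer N is spent here, and that of layer N + 1 takes its place.
      ≤⟨ +-monoʳ-≤ W (surplus-step q δ (S N) (S N₁) (S N₂)
           (layer-bound (proj₁ x) (proj₂ x))) ⟩
    W + (m * S N + q * S N₁ + m * S N₂ + P)
      ≡⟨ regroup q (below N) (below N₁) (below N₂) (S N) (S N₁) (S N₂) P ⟩
    m * (below N + S N) + q * (below N₁ + S N₁) + m * (below N₂ + S N₂) + P
      ≤⟨ +-monoˡ-≤ P (+-mono-≤ (+-mono-≤ (*-monoʳ-≤ m (below-suc N))
           (*-monoʳ-≤ q (below-suc N₁))) (*-monoʳ-≤ m (below-suc N₂))) ⟩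
    m * below N₁ + q * below N₂ + m * below (suc N₂) + P ∎
    where
    N₁ = suc N
    N₂ = suc N₁
    x = nonempty N ≤-refl
    W = m * below N + q * below N₁ + m * below N₂
    P = m * (S N₁ ∸ δ)
    swap : ∀ x y z → x + (y + z) ≡ y + (x + z)
    swap = solve-∀
    regroup : ∀ q a b c s t r p →
      suc q * a + q * b + suc q * c + (suc q * s + q * t + suc q * r + p)
      ≡ suc q * (a + s) + q * (b + t) + suc q * (c + r) + p
    regroup = solve-∀

  length-bound : ∀ N → (∀ i → i < N → ∃ λ x → e x ≡ suc i) →
                 N * (m * δ) ≤ (m + q + m) * n
  length-bound N nonempty = begin
    N * (m * δ)
      ≤⟨ accumulated N nonempty ⟩
    m * below N + q * below N₁ + m * below N₂ + m * (S N ∸ δ)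
      -- The first count stops before layer N, so the final surplus, at most m times that layer,
      -- fits there without raising any coefficient of `n`.
      ≤⟨ +-monoʳ-≤ W (*-monoʳ-≤ m (m∸n≤m (S N) δ)) ⟩
    m * below N + q * below N₁ + m * below N₂ + m * S N
      ≡⟨ regroup q (below N) (below N₁) (below N₂) (S N) ⟩
    m * (below N + S N) + q * below N₁ + m * below N₂
      ≤⟨ +-mono-≤ (+-mono-≤ (*-monoʳ-≤ m (≤-trans (below-suc N) (below≤n N₁)))
           (*-monoʳ-≤ q (below≤n N₁))) (*-monoʳ-≤ m (below≤n N₂)) ⟩
    m * n + q * n + m * n
      ≡⟨ collect m q n ⟩
    (m + q + m) * n ∎
    where
    N₁ = suc N
    N₂ = suc N₁
    W = m * below N + q * below N₁ + m * below N₂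
    regroup : ∀ q a b c s → suc q * a + q * b + suc q * c + suc q * s
                          ≡ suc q * (a + s) + q * b + suc q * c
    regroup = solve-∀
    collect : ∀ m q n → m * n + q * n + m * n ≡ (m + q + m) * n
    collect = solve-∀

-- The coefficient of n and the final bound.

3k∸4 : ∀ q → 3 * suc (suc q) ∸ 4 ≡ suc q + q + suc q
3k∸4 q = trans (cong (_∸ 4) (expand q)) (m+n∸m≡n 4 _)
  where
  expand : ∀ q → 3 * suc (suc q) ≡ 4 + (suc q + q + suc q)
  expand = solve-∀

theorem1p5 : (k : ℕ) → 3 ≤ k →
    Σ ℕ (λ C →
    (n δ : ℕ) (G : Graph n) → Connected G → Colorable k G →
    1 ≤ δ → MinDegreeAtLeast G δ →
    (u v : Fin n) → Σ ℕ (λ l → Walk G u v l ×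
    l * ((k ∸ 1) * δ) ≤ (3 * k ∸ 4) * n + C * ((k ∸ 1) * δ)))
theorem1p5 1 (s≤s ())
theorem1p5 (suc (suc q)) _ = 0 , λ n δ G conn (col , proper) _ minDeg u v →
  let open Distance G conn u
      -- Shifted by one, so that layer 0 is empty and every layer 1 + i has a predecessor.
      open Layers {q = q} G minDeg col proper (suc ∘ dist) (λ a → s≤s (dist-lipschitz a))
      nonempty : ∀ i → i < dist v → ∃ λ x → suc (dist x) ≡ suc i
      nonempty i i<d =
        -- The walk to `v` starts at distance 0, so every distance below `dist v` is attained; the
        -- shift places that vertex in layer 1 + i.
        let (x , eq) = intermediate-value G dist-lipschitz (dist-walk v)
                         (subst (_≤ i) (≡-sym dist-refl) z≤n) (<⇒≤ i<d)
        in x , cong suc eq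
  in dist v , dist-walk v , (begin
    dist v * (suc q * δ)         ≤⟨ length-bound (dist v) nonempty ⟩
    (suc q + q + suc q) * n      ≡⟨ cong (_* n) (3k∸4 q) ⟨
    (3 * suc (suc q) ∸ 4) * n    ≡⟨ +-identityʳ _ ⟨
    (3 * suc (suc q) ∸ 4) * n + 0 ∎)
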